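{- Let $n \geq 3$. Let $T_1$ and $T_2$ be $n$-leaf path trees, and suppose that for some $i$ the $i$th leaf is a bottom leaf both in $T_1$ and in $T_2$. Then $T_1$ and $T_2$ both parse the word $0^{k-1} 1 0^{n-k}$ for some $2 \leq k \leq n - 1$.
   Context: A binary tree is a rooted ordered tree in which each vertex has either $0$ or $2$ children; its leaves are numbered $1,2,\dots$ from left to right. Let $G$ be the context-free grammar with start symbols $0,1,2$ and rules $0\to 12$, $0\to 21$, $1\to 02$, $1\to 20$, $2\to 01$, $2\to 10$. An $n$-leaf binary tree $T$ parses a word $w$ of length $n$ on $\{0,1,2\}$ if there is a labeling of the vertices of $T$ by $0,1,2$ such that the leaves, from left to right, are labeled with the letters of $w$, and at every internal vertex the label of the vertex together with the labels of its left and right children form a rule of $G$ (i.e. the three labels are pairwise distinct). The level of a vertex is its distance from the root. A path tree is a binary tree with at most two vertices on each level. The two leaves on level $n-1$ of an $n$-leaf path tree are called its bottom leaves. -}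

module Defs where

open import Data.Fin.Base using (Fin; suc; toℕ)
open import Data.Fin.Patterns using (0F; 1F; 2F)
open import Data.List.Base as List using (List; []; _∷_; _++_; length; filter; replicate)
open import Data.Nat.Base using (ℕ; suc; _≤_; _∸_)
open import Data.Nat.Properties using (_≟_)
open import Data.Product.Base using (∃-syntax; _×_)
open import Data.Tree.Binary using (Tree; leaf; node; #leaves)
open import Data.Unit.Base using (⊤)
open import Data.Vec.Base as Vec using (Vec)
open import Relation.Binary.PropositionalEquality.Core using (_≡_)

BinaryTree : Set
BinaryTree = Tree ⊤ ⊤

-- A vertex is given by the path leading to it from the root.
data Vertex : BinaryTree → Set where
  root  : ∀ {t} → Vertex t
  left  : ∀ {l m r} → Vertex l → Vertex (node l m r)
  right : ∀ {l m r} → Vertex r → Vertex (node l m r)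

level : ∀ {t} → Vertex t → ℕ
level root      = 0
level (left v)  = suc (level v)
level (right v) = suc (level v)

vertices : ∀ t → List (Vertex t)
vertices (leaf _)     = root ∷ []
vertices (node l _ r) = root ∷ List.map left (vertices l) ++ List.map right (vertices r)

-- In left-to-right order.
leaves : ∀ t → Vec (Vertex t) (#leaves t)
leaves (leaf _)     = root Vec.∷ Vec.[]
leaves (node l _ r) = Vec.map left (leaves l) Vec.++ Vec.map right (leaves r)

-- Children v u w: the vertex v is internal, with left child u and right child w.
data Children : ∀ {t} → Vertex t → Vertex t → Vertex t → Set where
  at-root  : ∀ {l m r} → Children {node l m r} root (left root) (right root)
  in-left  : ∀ {l m r} {v u w : Vertex l} →
             Children v u w → Children {node l m r} (left v) (left u) (left w)
  in-right : ∀ {l m r} {v u w : Vertex r} →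
             Children v u w → Children {node l m r} (right v) (right u) (right w)

verticesOnLevel : ℕ → ∀ t → List (Vertex t)
verticesOnLevel d t = filter (λ v → level v ≟ d) (vertices t)

IsPathTree : BinaryTree → Set
IsPathTree t = ∀ d → length (verticesOnLevel d t) ≤ 2

-- Leaves are numbered from 1, whereas Fin indices start at 0.
IsBottomLeaf : BinaryTree → ℕ → Set
IsBottomLeaf t i =
  ∃[ j ] (suc (toℕ j) ≡ i × level (Vec.lookup (leaves t) j) ≡ #leaves t ∸ 1)

Letter : Set
Letter = Fin 3

Word : Set
Word = List Letter

data _⟶_·_ : Letter → Letter → Letter → Set where
  0⟶12 : 0F ⟶ 1F · 2F
  0⟶21 : 0F ⟶ 2F · 1F
  1⟶02 : 1F ⟶ 0F · 2F
  1⟶20 : 1F ⟶ 2F · 0F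
  2⟶01 : 2F ⟶ 0F · 1F
  2⟶10 : 2F ⟶ 1F · 0F

Parses : BinaryTree → Word → Set
Parses t word =
  ∃[ label ]
    ( Vec.toList (Vec.map label (leaves t)) ≡ word
    × (∀ {v u w : Vertex t} → Children v u w → label v ⟶ label u · label w))

-- 0ᵏ⁻¹ 1 0ⁿ⁻ᵏ, meant for 1 ≤ k ≤ n because of the truncated subtraction.
singleOne : ℕ → ℕ → Word
singleOne n k = replicate (k ∸ 1) 0F ++ 1F ∷ replicate (n ∸ k) 0F

{-# OPTIONS --safe #-}

-- An n-leaf path tree consists of a spine ending in a pair of sibling leaves, the bottom leaves,
-- with one further leaf attached to every other spine vertex. If one bottom leaf is labelled 1 and
-- all other leaves 0, the bottom spine vertex gets 2, and going up the spine the labels alternate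
-- between 2 and 1, so a path tree parses such a word whatever the sides of the attached leaves are.
-- It remains to choose a common bottom leaf other than the first and the last leaf: if the given
-- one is extremal, then both trees have the same bottom leaves, and its sibling serves.
module Submission where

open import Defs
open import Data.Bool.Base using (true; false)
open import Data.Empty using (⊥; ⊥-elim)
open import Data.Fin.Base using (Fin; toℕ; splitAt; _↑ˡ_; _↑ʳ_)
open import Data.Fin.Patterns using (0F; 1F; 2F)
open import Data.Fin.Properties using (join-splitAt; toℕ-↑ˡ)
open import Data.List.Base as List using ([]; _∷_; _++_; length; filter; replicate)
open import Data.List.Properties using (length-++; filter-++; filter-≐; ++-assoc)
open import Data.Nat.Base using (ℕ; zero; suc; _+_; _≤_; _≥_; _∸_; z≤n; s≤s)
open import Data.Nat.Properties
  using (_≟_; suc-injective; +-suc; +-identityʳ; m+n∸m≡n; m≤m+n; m≤n+m; +-mono-≤; ≤-refl; ≤-trans;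
         ≤-reflexive; module ≤-Reasoning)
open import Data.Product.Base using (∃-syntax; _×_; _,_)
open import Data.Sum.Base using (_⊎_; inj₁; inj₂)
open import Data.Tree.Binary using (leaf; node; #leaves)
open import Data.Vec.Base as Vec using ()
open import Data.Vec.Properties
  using (lookup-map; lookup-++ˡ; lookup-++ʳ; map-++; map-∘; toList-++)
open import Function.Base using (_∘_)
open import Relation.Binary.PropositionalEquality
  using (_≡_; refl; sym; trans; cong; cong₂; subst; module ≡-Reasoning)
open import Relation.Nullary.Decidable using (does)
open import Relation.Unary using (Decidable)

private
  variable
    a b d i : ℕ
    x y c : Letter
    t l r : BinaryTree

-- a and b count the leaves to the left and to the right of the two bottom leaves, which therefore
-- have the positions a and a + 1, counted from 0.
data Caterpillar : ℕ → ℕ → BinaryTree → Set where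
  cherry : Caterpillar 0 0 (node (leaf _) _ (leaf _))
  leafˡ  : Caterpillar a b t → Caterpillar (suc a) b (node (leaf _) _ t)
  leafʳ  : Caterpillar a b t → Caterpillar a (suc b) (node t _ (leaf _))

#leaves-caterpillar : Caterpillar a b t → #leaves t ≡ 2 + (a + b)
#leaves-caterpillar cherry = refl
#leaves-caterpillar (leafˡ p) = cong suc (#leaves-caterpillar p)
#leaves-caterpillar {a} (leafʳ {b = b} p) rewrite #leaves-caterpillar p =
  cong (2 +_) (trans (+-suc (a + b) 0) (trans (cong suc (+-identityʳ _)) (sym (+-suc a b))))

-- Level sizes, and path trees as caterpillars.

length-filter-map : ∀ {A B : Set} {P : B → Set} (P? : Decidable P) (f : A → B) xs →
  length (filter P? (List.map f xs)) ≡ length (filter (P? ∘ f) xs)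
length-filter-map P? f [] = refl
length-filter-map P? f (x ∷ xs) with does (P? (f x))
... | true  = cong suc (length-filter-map P? f xs)
... | false = length-filter-map P? f xs

width : ℕ → BinaryTree → ℕ
width d t = length (verticesOnLevel d t)

width-node : ∀ d l r → width (suc d) (node l _ r) ≡ width d l + width d r
width-node d l r = begin
  length (filter onLevel? (List.map left (vertices l) ++ List.map right (vertices r)))
    ≡⟨ cong length (filter-++ onLevel? (List.map left (vertices l)) _) ⟩
  length (filter onLevel? (List.map left (vertices l)) ++ filter onLevel? (List.map right (vertices r)))
    ≡⟨ length-++ (filter onLevel? (List.map left (vertices l))) ⟩
  length (filter onLevel? (List.map left (vertices l)))
    + length (filter onLevel? (List.map right (vertices r)))
    ≡⟨ cong₂ _+_ (shift left (λ _ → refl) (vertices l)) (shift right (λ _ → refl) (vertices r)) ⟩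
  width d l + width d r ∎
  where
  open ≡-Reasoning
  onLevel? : Decidable (λ (v : Vertex (node l _ r)) → level v ≡ suc d)
  onLevel? v = level v ≟ suc d
  shift : ∀ {s} (f : Vertex s → Vertex (node l _ r)) → (∀ v → level (f v) ≡ suc (level v)) → ∀ vs →
    length (filter onLevel? (List.map f vs)) ≡ length (filter (λ v → level v ≟ d) vs)
  shift f level-f vs = trans (length-filter-map onLevel? f vs)
    (cong length (filter-≐ (onLevel? ∘ f) (λ v → level v ≟ d)
      ( (λ {v} eq → suc-injective (trans (sym (level-f v)) eq))
      , (λ {v} eq → trans (level-f v) (cong suc eq))) vs))

1≤width₀ : ∀ t → 1 ≤ width 0 t
1≤width₀ (leaf _)     = s≤s z≤n
1≤width₀ (node _ _ _) = s≤s z≤n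

2≤width₁-node : ∀ l r → 2 ≤ width 1 (node l _ r)
2≤width₁-node l r = ≤-trans (+-mono-≤ (1≤width₀ l) (1≤width₀ r)) (≤-reflexive (sym (width-node 0 l r)))

pathTree-left : IsPathTree (node l _ r) → IsPathTree l
pathTree-left {l} {r} p d =
  ≤-trans (m≤m+n _ (width d r)) (≤-trans (≤-reflexive (sym (width-node d l r))) (p (suc d)))

pathTree-right : IsPathTree (node l _ r) → IsPathTree r
pathTree-right {l} {r} p d =
  ≤-trans (m≤n+m _ (width d l)) (≤-trans (≤-reflexive (sym (width-node d l r))) (p (suc d)))

-- If both children of the root were internal, level 2 would contain four vertices. Hence one child
-- is a leaf, and the induction goes on in the other one, whose levels are no wider than those of
-- the whole tree.
pathTree⇒caterpillar : ∀ l r → IsPathTree (node l _ r) → ∃[ a ] ∃[ b ] Caterpillar a b (node l _ r)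
pathTree⇒caterpillar (leaf _) (leaf _) p = 0 , 0 , cherry
pathTree⇒caterpillar (leaf _) (node l _ r) p
  with a , b , q ← pathTree⇒caterpillar l r (pathTree-right p) = suc a , b , leafˡ q
pathTree⇒caterpillar (node l _ r) (leaf _) p
  with a , b , q ← pathTree⇒caterpillar l r (pathTree-left p) = a , suc b , leafʳ q
pathTree⇒caterpillar t@(node l₁ _ r₁) u@(node l₂ _ r₂) p = ⊥-elim (4≰2 4≤2)
  where
  open ≤-Reasoning
  4≤2 : 4 ≤ 2
  4≤2 = begin
    4                      ≤⟨ +-mono-≤ (2≤width₁-node l₁ r₁) (2≤width₁-node l₂ r₂) ⟩
    width 1 t + width 1 u  ≡⟨ width-node 1 t u ⟨
    width 2 (node t _ u)   ≤⟨ p 2 ⟩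
    2                      ∎
  4≰2 : 4 ≤ 2 → ⊥
  4≰2 (s≤s (s≤s ()))

-- Positions of the bottom leaves.

leafLevel : ∀ t → Fin (#leaves t) → ℕ
leafLevel t j = level (Vec.lookup (leaves t) j)

leafLevel-↑ˡ : ∀ l r j → leafLevel (node l _ r) (j ↑ˡ #leaves r) ≡ suc (leafLevel l j)
leafLevel-↑ˡ l r j = cong level
  (trans (lookup-++ˡ (Vec.map left (leaves l)) (Vec.map right (leaves r)) j) (lookup-map j left (leaves l)))

leafLevel-↑ʳ : ∀ l r j → leafLevel (node l _ r) (#leaves l ↑ʳ j) ≡ suc (leafLevel r j)
leafLevel-↑ʳ l r j = cong level
  (trans (lookup-++ʳ (Vec.map left (leaves l)) (Vec.map right (leaves r)) j) (lookup-map j right (leaves r)))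

Bottom : ℕ → ℕ → Set
Bottom a i = i ≡ a ⊎ i ≡ suc a

bottom-suc : Bottom a i → Bottom (suc a) (suc i)
bottom-suc (inj₁ eq) = inj₁ (cong suc eq)
bottom-suc (inj₂ eq) = inj₂ (cong suc eq)

-- Each attached leaf lengthens the spine by one, so `suc (a + b)` is the level of the cherry's
-- leaves. A leaf attached at the root is on level 1, which is too high up.
deepest⇒bottom : Caterpillar a b t → ∀ j → leafLevel t j ≡ suc (a + b) → Bottom a (toℕ j)
deepest⇒bottom cherry 0F eq = inj₁ refl
deepest⇒bottom cherry 1F eq = inj₂ refl
deepest⇒bottom (leafˡ {t = t} p) (Fin.suc j) eq =
  bottom-suc (deepest⇒bottom p j (suc-injective (trans (sym (leafLevel-↑ʳ (leaf _) t j)) eq)))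
deepest⇒bottom {a} (leafʳ {b = b} {t = t} p) j eq
  with splitAt (#leaves t) j | join-splitAt (#leaves t) 1 j
... | inj₁ k | refl rewrite toℕ-↑ˡ k 1 = deepest⇒bottom p k
  (suc-injective (trans (sym (leafLevel-↑ˡ t (leaf _) k)) (trans eq (cong suc (+-suc a b)))))
-- The attached leaf: its level is 1, whereas `eq` asks for at least 2.
... | inj₂ 0F | refl
  with () ← trans (sym (leafLevel-↑ʳ t (leaf _) 0F)) (trans eq (cong suc (+-suc a b)))

-- The shift from `suc i` to `i` passes from numbering leaves from 1 to counting positions from 0.
bottomLeaf⇒bottom : Caterpillar a b t → IsBottomLeaf t (suc i) → Bottom a i
bottomLeaf⇒bottom p (j , refl , eq) =
  deepest⇒bottom p j (trans eq (cong (_∸ 1) (#leaves-caterpillar p)))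

-- Parsing caterpillars.

ParsesFrom : Letter → BinaryTree → Word → Set
ParsesFrom c t w =
  ∃[ label ]
    ( label root ≡ c
    × Vec.toList (Vec.map label (leaves t)) ≡ w
    × (∀ {u v₁ v₂ : Vertex t} → Children u v₁ v₂ → label u ⟶ label v₁ · label v₂))

parsesFrom-leaf : ∀ c → ParsesFrom c (leaf _) (c ∷ [])
parsesFrom-leaf c = (λ _ → c) , refl , refl , λ ()

-- Since the labels of both subtree roots are prescribed, the labelings can be glued: the only new
-- triple is the one at the new root, and it is `rule`.
parsesFrom-node : ∀ {w₁ w₂} → c ⟶ x · y → ParsesFrom x l w₁ → ParsesFrom y r w₂ →
  ParsesFrom c (node l _ r) (w₁ ++ w₂)
parsesFrom-node {c} {l = l} {r = r} rule (f , refl , refl , f-rules) (g , refl , refl , g-rules) =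
  label , refl , word , rules
  where
  open ≡-Reasoning
  label : Vertex (node l _ r) → Letter
  label root      = c
  label (left v)  = f v
  label (right v) = g v
  word : Vec.toList (Vec.map label (leaves (node l _ r)))
    ≡ Vec.toList (Vec.map f (leaves l)) ++ Vec.toList (Vec.map g (leaves r))
  word = begin
    Vec.toList (Vec.map label (Vec.map left (leaves l) Vec.++ Vec.map right (leaves r)))
      ≡⟨ cong Vec.toList (map-++ label (Vec.map left (leaves l)) _) ⟩
    Vec.toList (Vec.map label (Vec.map left (leaves l)) Vec.++ Vec.map label (Vec.map right (leaves r)))
      ≡⟨ cong Vec.toList (cong₂ Vec._++_ (map-∘ label left (leaves l)) (map-∘ label right (leaves r))) ⟨
    Vec.toList (Vec.map f (leaves l) Vec.++ Vec.map g (leaves r))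
      ≡⟨ toList-++ (Vec.map f (leaves l)) _ ⟩
    Vec.toList (Vec.map f (leaves l)) ++ Vec.toList (Vec.map g (leaves r)) ∎
  rules : ∀ {u v₁ v₂} → Children u v₁ v₂ → label u ⟶ label v₁ · label v₂
  rules at-root      = rule
  rules (in-left q)  = f-rules q
  rules (in-right q) = g-rules q

replicate-∷ʳ : ∀ {A : Set} n {z : A} → replicate n z ++ z ∷ [] ≡ z ∷ replicate n z
replicate-∷ʳ zero    = refl
replicate-∷ʳ (suc n) = cong (_ ∷_) (replicate-∷ʳ n)

replicate-++-∷ : ∀ {A : Set} n {z : A} zs → replicate n z ++ z ∷ zs ≡ z ∷ replicate n z ++ zs
replicate-++-∷ zero    zs = refl
replicate-++-∷ (suc n) zs = cong (_ ∷_) (replicate-++-∷ n zs)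

-- A root labelled 0 could not have a sibling leaf labelled 0, so the induction has to keep the root
-- label nonzero.
ParsesFrom12 : BinaryTree → Word → Set
ParsesFrom12 t w = ParsesFrom 1F t w ⊎ ParsesFrom 2F t w

-- The rule makes `x` and `y` the letters 0 and 1 in some order, so one induction covers both
-- choices of the bottom leaf that carries the 1.
caterpillar-parses : 2F ⟶ x · y → Caterpillar a b t →
  ParsesFrom12 t (replicate a 0F ++ x ∷ y ∷ replicate b 0F)
caterpillar-parses rule cherry = inj₂ (parsesFrom-node rule (parsesFrom-leaf _) (parsesFrom-leaf _))
caterpillar-parses rule (leafˡ p) with caterpillar-parses rule p
... | inj₁ q = inj₂ (parsesFrom-node 2⟶01 (parsesFrom-leaf 0F) q)
... | inj₂ q = inj₁ (parsesFrom-node 1⟶02 (parsesFrom-leaf 0F) q)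
caterpillar-parses {x} {y} {a} rule (leafʳ {b = b} {t = t} p) =
  -- The new 0 arrives at the end of the word, while `replicate (suc b) 0F` has it in front of the
  -- final block.
  subst (ParsesFrom12 (node t _ (leaf _)))
    (trans (++-assoc (replicate a 0F) _ _)
      (cong (λ w → replicate a 0F ++ x ∷ y ∷ w) (replicate-∷ʳ b)))
    (extend (caterpillar-parses rule p))
  where
  extend : ∀ {w} → ParsesFrom12 t w → ParsesFrom12 (node t _ (leaf _)) (w ++ 0F ∷ [])
  extend (inj₁ q) = inj₂ (parsesFrom-node 2⟶10 q (parsesFrom-leaf 0F))
  extend (inj₂ q) = inj₁ (parsesFrom-node 1⟶20 q (parsesFrom-leaf 0F))

parsesFrom12⇒parses : ∀ {w} → ParsesFrom12 t w → Parses t w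
parsesFrom12⇒parses (inj₁ (f , _ , eq , rules)) = f , eq , rules
parsesFrom12⇒parses (inj₂ (f , _ , eq , rules)) = f , eq , rules

parses-bottom : Caterpillar a b t → Bottom a i → Parses t (singleOne (2 + (a + b)) (suc i))
parses-bottom {a} {b} {t} p (inj₁ refl) =
  subst (Parses t) (cong (λ n → replicate a 0F ++ 1F ∷ replicate n 0F) (sym exponent))
    (parsesFrom12⇒parses (caterpillar-parses 2⟶10 p))
  where
  exponent : suc (a + b) ∸ a ≡ suc b
  exponent = trans (cong (_∸ a) (sym (+-suc a b))) (m+n∸m≡n a (suc b))
parses-bottom {a} {b} {t} p (inj₂ refl) =
  subst (Parses t)
    (trans (replicate-++-∷ a _)
      (cong (λ n → 0F ∷ replicate a 0F ++ 1F ∷ replicate n 0F) (sym (m+n∸m≡n a b))))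
    (parsesFrom12⇒parses (caterpillar-parses 2⟶01 p))

-- Choice of a common bottom leaf.

CommonInterior : ℕ → ℕ → ℕ → Set
CommonInterior m a₁ a₂ = ∃[ j ] (1 ≤ j × j ≤ m × Bottom a₁ j × Bottom a₂ j)

-- With `m + 2` leaves, the positions 1 to `m` are those other than first and last. The left bottom
-- leaf serves unless it is the first leaf; then its sibling at position 1 does, because `1 ≤ m`.
sameInterior : ∀ {m} a b → m ≡ a + b → 1 ≤ m → CommonInterior m a a
sameInterior zero    b refl 1≤b = 1 , ≤-refl , 1≤b , inj₂ refl , inj₂ refl
sameInterior (suc a) b refl _   = suc a , s≤s z≤n , m≤m+n (suc a) b , inj₁ refl , inj₁ refl

-- If the given leaf is a left bottom leaf in one tree and a right one in the other, it is itself
-- interior: being right it is not the first leaf, being left it is not the last.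
commonInterior : ∀ {m} a₁ b₁ a₂ b₂ → m ≡ a₁ + b₁ → m ≡ a₂ + b₂ → 1 ≤ m →
  Bottom a₁ i → Bottom a₂ i → CommonInterior m a₁ a₂
commonInterior a₁ b₁ _  _  m≡ _  1≤m (inj₁ refl) (inj₁ refl) = sameInterior a₁ b₁ m≡ 1≤m
commonInterior a₁ b₁ _  _  m≡ _  1≤m (inj₂ refl) (inj₂ refl) = sameInterior a₁ b₁ m≡ 1≤m
commonInterior a₁ b₁ _  _  m≡ _  _   (inj₁ refl) (inj₂ refl) =
  a₁ , s≤s z≤n , ≤-trans (m≤m+n a₁ b₁) (≤-reflexive (sym m≡)) , inj₁ refl , inj₂ refl
commonInterior _  _  a₂ b₂ _  m≡ _   (inj₂ refl) (inj₁ refl) =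
  a₂ , s≤s z≤n , ≤-trans (m≤m+n a₂ b₂) (≤-reflexive (sym m≡)) , inj₂ refl , inj₁ refl

proposition9 : (n : ℕ) → n ≥ 3 →
    (T₁ T₂ : BinaryTree) →
    #leaves T₁ ≡ n → #leaves T₂ ≡ n →
    IsPathTree T₁ → IsPathTree T₂ →
    ∃[ i ] (IsBottomLeaf T₁ i × IsBottomLeaf T₂ i) →
    ∃[ k ] (2 ≤ k × k ≤ n ∸ 1 × Parses T₁ (singleOne n k) × Parses T₂ (singleOne n k))
proposition9 _ (s≤s ()) (leaf _) _ refl _ _ _ _
proposition9 _ (s≤s ()) _ (leaf _) _ refl _ _ _
proposition9 _ _ _ _ _ _ _ _ (zero , (_ , () , _) , _)
-- Here `m` is `n - 2`, the number of attached leaves in either tree, and `k` will be `suc j` for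
-- the chosen position `j`.
proposition9 (suc (suc m)) (s≤s (s≤s 1≤m)) T₁@(node l₁ _ r₁) T₂@(node l₂ _ r₂) n₁ n₂ p₁ p₂
  (suc i , bottom₁ , bottom₂)
  with a₁ , b₁ , q₁ ← pathTree⇒caterpillar l₁ r₁ p₁
  with a₂ , b₂ , q₂ ← pathTree⇒caterpillar l₂ r₂ p₂
  = let
      m≡₁ = suc-injective (suc-injective (trans (sym n₁) (#leaves-caterpillar q₁)))
      m≡₂ = suc-injective (suc-injective (trans (sym n₂) (#leaves-caterpillar q₂)))
      j , 1≤j , j≤m , j₁ , j₂ = commonInterior a₁ b₁ a₂ b₂ m≡₁ m≡₂ 1≤m
        (bottomLeaf⇒bottom q₁ bottom₁) (bottomLeaf⇒bottom q₂ bottom₂)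
    in suc j , s≤s 1≤j , s≤s j≤m
      , subst (λ m → Parses T₁ (singleOne (2 + m) (suc j))) (sym m≡₁) (parses-bottom q₁ j₁)
      , subst (λ m → Parses T₂ (singleOne (2 + m) (suc j))) (sym m≡₂) (parses-bottom q₂ j₂)
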